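{- For all countable ordinals $\xi\ge 1$ we have \[ \mathrm{rbc}(\xi)\le\xi+1\quad\text{and}\quad\mathrm{apb}(\xi)\le\xi+2 . \]
   Context: Notation. $\omega=\{0,1,2,\dots\}$, $\omega_1$ is the first uncountable ordinal, $\mathcal{N}=\omega^\omega$ is the Baire space with the product topology. For $\alpha\in\mathcal{N}$, $\alpha^\ast=(i\mapsto\alpha(i+1))$. $\boldsymbol{\Pi}^0_\xi$ ($1\le\xi<\omega_1$) are the usual multiplicative Borel classes. Coding of finite sequences. For $n\ge 1$, $\langle u_0,\dots,u_{n-1}\rangle=p_0^{u_0+1}\cdots p_{n-1}^{u_{n-1}+1}$, where $p_0<p_1<\dots$ are the primes; $\langle\emptyset\rangle=1$. If $s=\langle u_0,\dots,u_{n-1}\rangle$ and $i<n$, then $(s)_i:=u_i$; if $i\ge n$ or $s$ is not in the image of $\langle\cdot\rangle$, then $(s)_i:=0$. Put $q_k=(k)_0/((k)_1+1)$. Basic open sets. For $\mathcal{X}=\mathcal{N}$ and $\mathcal{X}=\omega\times\omega$ a compatible metric $d_{\mathcal{X}}$ and a dense sequence $(r^{\mathcal{X}}_i)_{i\in\omega}$ (forming a recursive presentation) are fixed, and $N(\mathcal{X},s)$ is the open $d_{\mathcal{X}}$-ball with center $r^{\mathcal{X}}_{(s)_0}$ and radius $q_{(s)_1}$ (empty if the radius is $0$). For $\mathcal{N}$ the choice is: $d_{\mathcal{N}}(\alpha,\beta)=(n+1)^{ -1}$ with $n$ least such that $\alpha(n)\ne\beta(n)$ if $\alpha\ne\beta$,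 $d_{\mathcal{N}}(\alpha,\alpha)=0$, and $r^{\mathcal{N}}_s(i)=(s)_i$. Define $\mathrm{U}^{\omega\times\omega}(\alpha,x)\iff(\exists k\in\omega)[x\in N(\omega\times\omega,\alpha(k))]$ for $\alpha\in\mathcal{N}$, $x\in\omega\times\omega$. Partial functions $\{\alpha\}$. For $\alpha\in\mathcal{N}$ let $\{\alpha\}:\omega\rightharpoonup\mathcal{N}$ be the partial function such that $\{\alpha\}(n)$ is defined (written $\{\alpha\}(n)\downarrow$) exactly when there is a unique $\beta\in\mathcal{N}$ such that for all $s\in\omega$: $\beta\in N(\mathcal{N},s)\iff\mathrm{U}^{\omega\times\omega}(\alpha,(n,s))$; in that case $\{\alpha\}(n)$ is this $\beta$. Borel codes. Define $\mathrm{BC}_\xi\subseteq\mathcal{N}$ for $\xi<\omega_1$ by recursion: $\alpha\in\mathrm{BC}_0\iff\alpha(0)=0$; and for $\xi\ge 1$, $\alpha\in\mathrm{BC}_\xi\iff\alpha(0)=1$ and for every $n$ there is $\zeta<\xi$ with $\{\alpha^\ast\}(n)\downarrow$ and $\{\alpha^\ast\}(n)\in\mathrm{BC}_\zeta$. The functions $\mathrm{rbc},\mathrm{apb}:\omega_1\setminus\{0\}\to\omega_1\setminus\{0\}$. $\mathrm{rbc}(\xi)$ is the least $\eta<\omega_1$ such that $\mathrm{BC}_\xi$ is a $\boldsymbol{\Pi}^0_\eta$ subset of $\mathcal{N}$. $\mathrm{apb}(1)=1$, and for $\xi>1$, $\mathrm{apb}(\xi)=\sup\{\max\{\mathrm{apb}(\eta),\mathrm{rbc}(\eta)+1\}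 : 1\le\eta<\xi\}+1$. -}

module Defs where

open import Data.Fin.Base using (Fin)
open import Data.Integer.Base using (+_)
open import Data.List.Base using (List; []; _∷_)
open import Data.List.Relation.Unary.All using (All; []; _∷_)
open import Data.Nat.Base
  using (ℕ; zero; suc; _+_; _*_; _^_; _≤_; _<_; _!; s≤s; z<s; NonZero;
         >-nonZero; >-nonZero⁻¹; nonTrivial⇒n>1)
open import Data.Nat.Divisibility
  using (_∣_; _∣?_; divides; m∣m*n; ∣-trans; ∣1⇒≡1; ∣m+n∣m⇒∣n; m≤n⇒m!∣n!)
open import Data.Nat.Induction using (Acc; acc; <-wellFounded)
open import Data.Nat.ListAction using (product)
open import Data.Nat.Primality using (Prime; prime?; prime⇒nonZero; prime⇒nonTrivial; ¬prime[1])
open import Data.Nat.Primality.Factorisation using (factorise; PrimeFactorisation)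
import Data.Nat.Properties as ℕₚ
open import Data.Product.Base using (∃; _×_; _,_; proj₁; proj₂)
open import Data.Rational.Unnormalised.Base as ℚ using (ℚᵘ; mkℚᵘ; 0ℚᵘ)
open import Data.Sum.Base using (_⊎_)
open import Data.Vec.Base using (Vec; []; _∷_; lookup)
open import Data.Vec.Relation.Binary.Pointwise.Inductive using (Pointwise)
open import Function.Bundles using (_⇔_)
open import Level using (0ℓ)
open import Relation.Binary.PropositionalEquality
  using (_≡_; _≢_; _≗_; refl; sym; trans; cong; subst)
open import Relation.Nullary using (¬_; Dec; yes; no; contradiction; _×-dec_)
open import Relation.Unary using (Pred; Decidable; _≐_; ⋃; ∁)

------------------------------------------------------------------------
-- Countable ordinals

-- `lsup f` is the least ordinal strictly above every `f n`.  Every element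
-- denotes a countable ordinal, and every countable ordinal is denoted: a
-- nonzero one is `lsup` of any enumeration of its predecessors.  An ordinal
-- has many denotations, so equality of ordinals is `_≈ᵒ_`, not `_≡_`.
data ω₁ : Set where
  0ᵒ   : ω₁
  lsup : (ℕ → ω₁) → ω₁

infix 4 _≤ᵒ_ _<ᵒ_ _≈ᵒ_

data _≤ᵒ_ : ω₁ → ω₁ → Set
data _<ᵒ_ : ω₁ → ω₁ → Set

data _≤ᵒ_ where
  0≤    : ∀ {η} → 0ᵒ ≤ᵒ η
  lsup≤ : ∀ {f η} → (∀ n → f n <ᵒ η) → lsup f ≤ᵒ η

data _<ᵒ_ where
  <lsup : ∀ {ξ f} n → ξ ≤ᵒ f n → ξ <ᵒ lsup f

_≈ᵒ_ : ω₁ → ω₁ → Set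
ξ ≈ᵒ η = ξ ≤ᵒ η × η ≤ᵒ ξ

sucᵒ : ω₁ → ω₁
sucᵒ ξ = lsup λ _ → ξ

1ᵒ : ω₁
1ᵒ = sucᵒ 0ᵒ

IsLeast : ∀ {ℓ} → Pred ω₁ ℓ → ω₁ → Set ℓ
IsLeast P η = P η × (∀ ζ → P ζ → η ≤ᵒ ζ)

IsSup : ∀ {ℓ} → Pred ω₁ ℓ → ω₁ → Set ℓ
IsSup P σ = (∀ ζ → P ζ → ζ ≤ᵒ σ) × (∀ τ → (∀ ζ → P ζ → ζ ≤ᵒ τ) → σ ≤ᵒ τ)

IsMax : ω₁ → ω₁ → ω₁ → Set
IsMax ξ η μ = (η ≤ᵒ ξ × μ ≈ᵒ ξ) ⊎ (ξ ≤ᵒ η × μ ≈ᵒ η)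

------------------------------------------------------------------------
-- Baire space and its Borel classes

𝒩 : Set
𝒩 = ℕ → ℕ

tail : 𝒩 → 𝒩
tail α i = α (suc i)

Agree : ℕ → 𝒩 → 𝒩 → Set
Agree n α β = ∀ i → i < n → α i ≡ β i

Open : Pred 𝒩 0ℓ → Set
Open A = ∀ α → A α → ∃ λ n → ∀ β → Agree n α β → A β

-- Both classes are empty at index 0.
data Σ⁰ : ω₁ → Pred 𝒩 0ℓ → Set₁
data Π⁰ : ω₁ → Pred 𝒩 0ℓ → Set₁

data Σ⁰ where
  isOpen  : ∀ {ξ A} → ξ ≈ᵒ 1ᵒ → Open A → Σ⁰ ξ A
  isUnion : ∀ {ξ A} → 1ᵒ <ᵒ ξ → (ζ : ℕ → ω₁) (B : ℕ → Pred 𝒩 0ℓ) →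
            (∀ n → 1ᵒ ≤ᵒ ζ n × ζ n <ᵒ ξ × Π⁰ (ζ n) (B n)) →
            A ≐ ⋃ ℕ B → Σ⁰ ξ A

data Π⁰ where
  isComplement : ∀ {ξ A} (B : Pred 𝒩 0ℓ) → Σ⁰ ξ B → A ≐ ∁ B → Π⁰ ξ A

------------------------------------------------------------------------
-- Enumeration of the primes

∃-least : ∀ {P : Pred ℕ 0ℓ} → Decidable P → ∀ n → P n →
          ∃ λ m → P m × (∀ k → k < m → ¬ P k)
∃-least {P} P? n = go n (<-wellFounded n)
  where
  go : ∀ n → Acc _<_ n → P n → ∃ λ m → P m × (∀ k → k < m → ¬ P k)
  go n (acc rs) pn with ℕₚ.anyUpTo? P? n
  ... | yes (k , k<n , pk) = go k (rs k<n) pk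
  ... | no  none           = n , pn , λ k k<n pk → none (k , k<n , pk)

prime-divisor : ∀ n → 1 < n → ∃ λ p → Prime p × p ∣ n
prime-divisor n 1<n = go factors isFactorisation factorsPrime
  where
  open PrimeFactorisation (factorise n {{>-nonZero (ℕₚ.<-trans z<s 1<n)}})
  go : ∀ ps → n ≡ product ps → All Prime ps → ∃ λ p → Prime p × p ∣ n
  go []       eq _        = contradiction (sym eq) (ℕₚ.<⇒≢ 1<n)
  go (p ∷ ps) eq (pp ∷ _) = p , pp , subst (p ∣_) (sym eq) (m∣m*n (product ps))

n∣n! : ∀ n .{{_ : NonZero n}} → n ∣ n !
n∣n! (suc n) = m∣m*n (n !)

prime-above : ∀ n → ∃ λ p → n < p × Prime p
prime-above n with prime-divisor (n ! + 1) 1<n!+1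
  where
  1<n!+1 : 1 < n ! + 1
  1<n!+1 = ℕₚ.+-monoˡ-≤ 1 (>-nonZero⁻¹ (n !) {{n ℕₚ.!≢0}})
... | p , pp , p∣n!+1 = p , ℕₚ.≰⇒> p≰n , pp
  where
  p≰n : ¬ p ≤ n
  p≰n p≤n = ¬prime[1] (subst Prime (∣1⇒≡1 (∣m+n∣m⇒∣n p∣n!+1 p∣n!)) pp)
    where
    p∣n! : p ∣ n !
    p∣n! = ∣-trans (n∣n! p {{prime⇒nonZero pp}}) (m≤n⇒m!∣n! p≤n)

IsNextPrime : ℕ → ℕ → Set
IsNextPrime n p = (n < p × Prime p) × (∀ k → k < p → ¬ (n < k × Prime k))

next-prime : ∀ n → ∃ (IsNextPrime n)
next-prime n = ∃-least (λ k → (n ℕₚ.<? k) ×-dec prime? k)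
                       (proj₁ (prime-above n)) (proj₂ (prime-above n))

prime# : ℕ → ℕ
prime# zero    = proj₁ (next-prime 0)
prime# (suc i) = proj₁ (next-prime (prime# i))

prime#-prime : ∀ i → Prime (prime# i)
prime#-prime zero    = proj₂ (proj₁ (proj₂ (next-prime 0)))
prime#-prime (suc i) = proj₂ (proj₁ (proj₂ (next-prime (prime# i))))

prime#-nonZero : ∀ i → NonZero (prime# i)
prime#-nonZero i = prime⇒nonZero (prime#-prime i)

1<prime# : ∀ i → 1 < prime# i
1<prime# i = nonTrivial⇒n>1 _ {{prime⇒nonTrivial (prime#-prime i)}}

n<m^n : ∀ m n → 1 < m → n < m ^ n
n<m^n m zero    1<m = z<s
n<m^n m (suc n) 1<m = ℕₚ.≤-<-trans (n<m^n m n 1<m) (ℕₚ.^-monoʳ-< m 1<m (ℕₚ.n<1+n n))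

------------------------------------------------------------------------
-- Coding of finite sequences

codeFrom : ℕ → List ℕ → ℕ
codeFrom j []       = 1
codeFrom j (u ∷ us) = prime# j ^ suc u * codeFrom (suc j) us

⟨_⟩ : List ℕ → ℕ
⟨_⟩ = codeFrom 0

codeFrom>0 : ∀ j us → 0 < codeFrom j us
codeFrom>0 j []       = z<s
codeFrom>0 j (u ∷ us) =
  ℕₚ.*-mono-< {0} {_} {0} (ℕₚ.m^n>0 _ {{prime#-nonZero j}} (suc u))
              (codeFrom>0 (suc j) us)

codeFrom? : ∀ j s → Dec (∃ λ us → codeFrom j us ≡ s)
codeFrom? j s = go j s (<-wellFounded s)
  where
  go : ∀ j s → Acc _<_ s → Dec (∃ λ us → codeFrom j us ≡ s)
  go j zero _ = no λ (us , eq) → ℕₚ.<-irrefl (sym eq) (codeFrom>0 j us)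
  go j s@(suc _) (acc rs) with s ℕₚ.≟ 1
  ... | yes s≡1 = yes ([] , sym s≡1)
  ... | no  s≢1 with ℕₚ.anyUpTo? head? s
    where
    p^ : ℕ → ℕ
    p^ u = prime# j ^ suc u

    1<p^ : ∀ u → 1 < p^ u
    1<p^ u = ℕₚ.<-≤-trans (1<prime# j)
      (ℕₚ.m≤m*n _ _ {{ℕₚ.m^n≢0 _ u {{prime#-nonZero j}}}})

    head? : Decidable (λ u → ∃ λ us → p^ u * codeFrom (suc j) us ≡ s)
    head? u with p^ u ∣? s
    ... | no  p^∤s = no λ (us , eq) →
            p^∤s (divides (codeFrom (suc j) us) (trans (sym eq) (ℕₚ.*-comm (p^ u) _)))
    ... | yes (divides zero ())
    ... | yes (divides t@(suc _) s≡t*p^)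
          with go (suc j) t (rs (subst (t <_) (sym s≡t*p^) (ℕₚ.m<m*n t (p^ u) (1<p^ u))))
    ...   | yes (us , eq) = yes (us , trans (cong (p^ u *_) eq) (trans (ℕₚ.*-comm (p^ u) t) (sym s≡t*p^)))
    ...   | no  none        = no λ (us , eq) → none
            (us , ℕₚ.*-cancelˡ-≡ _ _ (p^ u) {{>-nonZero (ℕₚ.<-trans z<s (1<p^ u))}}
                    (trans eq (trans s≡t*p^ (ℕₚ.*-comm t (p^ u)))))
  ...   | yes (u , _ , us , eq) = yes (u ∷ us , eq)
  ...   | no  none = no λ where
            ([]     , eq) → s≢1 (sym eq)
            (u ∷ us , eq) → none (u , u<s u us eq , us , eq)
    where
    u<s : ∀ u us → codeFrom j (u ∷ us) ≡ s → u < s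
    u<s u us eq = subst (u <_) eq
      (ℕₚ.<-≤-trans (n<m^n _ u (1<prime# j)) (ℕₚ.≤-trans
        (ℕₚ.^-monoʳ-≤ (prime# j) {{prime#-nonZero j}} (ℕₚ.n≤1+n u))
        (ℕₚ.m≤m*n (prime# j ^ suc u) _ {{>-nonZero (codeFrom>0 (suc j) us)}})))

-- The entry at index `i`, or 0 beyond the end.
entry : List ℕ → ℕ → ℕ
entry []       i       = 0
entry (u ∷ us) zero    = u
entry (u ∷ us) (suc i) = entry us i

infix 9 [_]_

-- `[ s ] i` is (s)ᵢ.
[_]_ : ℕ → ℕ → ℕ
[ s ] i with codeFrom? 0 s
... | yes (us , _) = entry us i
... | no  _        = 0

-- q k = (k)₀ / ((k)₁ + 1)
q : ℕ → ℚᵘ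
q k = mkℚᵘ (+ ([ k ] 0)) ([ k ] 1)

------------------------------------------------------------------------
-- Metrics and recursive presentations

-- A Dedekind real, given by the set of rationals strictly above it.
record ℝ : Set₁ where
  field
    Above     : ℚᵘ → Set
    inhabited : ∃ λ p → Above p
    bounded   : ∃ λ p → ¬ Above p
    upward    : ∀ {p r} → Above p → p ℚ.< r → Above r
    rounded   : ∀ {p} → Above p → ∃ λ r → r ℚ.< p × Above r

infix 4 _<ʳ_ _≤ʳ_

_<ʳ_ : ℝ → ℚᵘ → Set
x <ʳ p = ℝ.Above x p

_≤ʳ_ : ℝ → ℚᵘ → Set
x ≤ʳ p = ∀ r → p ℚ.< r → x <ʳ r

record IsMetric {X : Set} (d : X → X → ℝ) : Set where
  field
    nonNegative : ∀ x y p → d x y <ʳ p → 0ℚᵘ ℚ.< p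
    reflexive   : ∀ x → d x x ≤ʳ 0ℚᵘ
    separated   : ∀ x y → d x y ≤ʳ 0ℚᵘ → x ≡ y
    symmetric   : ∀ x y p → d x y <ʳ p → d y x <ʳ p
    triangle    : ∀ x y z p r → d x y <ʳ p → d y z <ʳ r → d x z <ʳ p ℚ.+ r

-- Codes for the partial recursive functions, and their graphs.
data Rec : ℕ → Set where
  zeroᶠ       : ∀ {n} → Rec n
  succᶠ       : Rec 1
  proj        : ∀ {n} → Fin n → Rec n
  comp        : ∀ {m n} → Rec m → Vec (Rec n) m → Rec n
  primrec     : ∀ {n} → Rec n → Rec (2 + n) → Rec (suc n)
  minimise    : ∀ {n} → Rec (suc n) → Rec n

infix 4 _⦅_⦆↦_

data _⦅_⦆↦_ : ∀ {n} → Rec n → Vec ℕ n → ℕ → Set where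
  zeroᶠ    : ∀ {n} {xs : Vec ℕ n} → zeroᶠ ⦅ xs ⦆↦ 0
  succᶠ    : ∀ {x} → succᶠ ⦅ x ∷ [] ⦆↦ suc x
  proj     : ∀ {n} {i : Fin n} {xs} → proj i ⦅ xs ⦆↦ lookup xs i
  comp     : ∀ {m n} {f : Rec m} {gs : Vec (Rec n) m} {xs ys z} →
             Pointwise (λ g y → g ⦅ xs ⦆↦ y) gs ys → f ⦅ ys ⦆↦ z →
             comp f gs ⦅ xs ⦆↦ z
  primrec₀ : ∀ {n} {f : Rec n} {g xs y} →
             f ⦅ xs ⦆↦ y → primrec f g ⦅ 0 ∷ xs ⦆↦ y
  primrec₊ : ∀ {n} {f : Rec n} {g xs k y z} →
             primrec f g ⦅ k ∷ xs ⦆↦ y → g ⦅ k ∷ y ∷ xs ⦆↦ z →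
             primrec f g ⦅ suc k ∷ xs ⦆↦ z
  minimise : ∀ {n} {f : Rec (suc n)} {xs k} →
             f ⦅ k ∷ xs ⦆↦ 0 → (∀ j → j < k → ∃ λ y → f ⦅ j ∷ xs ⦆↦ suc y) →
             minimise f ⦅ xs ⦆↦ k

IsRecursive₄ : (ℕ → ℕ → ℕ → ℕ → Set) → Set
IsRecursive₄ R = ∃ λ χ → ∀ i j m k →
  (R i j m k × χ ⦅ i ∷ j ∷ m ∷ k ∷ [] ⦆↦ 1) ⊎ (¬ R i j m k × χ ⦅ i ∷ j ∷ m ∷ k ∷ [] ⦆↦ 0)

-- The topology of ω × ω is discrete, so `compatible` says that every point
-- is isolated for d.
record RecursivePresentation-ω×ω : Set₁ where
  field
    d           : ℕ × ℕ → ℕ × ℕ → ℝ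
    r           : ℕ → ℕ × ℕ
    isMetric    : IsMetric d
    compatible  : ∀ x → ∃ λ ε → 0ℚᵘ ℚ.< ε × (∀ y → d x y <ʳ ε → x ≡ y)
    dense       : ∀ x ε → 0ℚᵘ ℚ.< ε → ∃ λ i → d (r i) x <ʳ ε
    recursive-≤ : IsRecursive₄ λ i j m k → d (r i) (r j) ≤ʳ mkℚᵘ (+ m) k
    recursive-< : IsRecursive₄ λ i j m k → d (r i) (r j) <ʳ mkℚᵘ (+ m) k

-- `Dist𝒩 α β δ` is d(α,β) = δ; note that `mkℚᵘ (+ 1) n` is 1/(n+1).
data Dist𝒩 (α β : 𝒩) : ℚᵘ → Set where
  equal  : α ≗ β → Dist𝒩 α β 0ℚᵘ
  differ : ∀ n → Agree n α β → α n ≢ β n → Dist𝒩 α β (mkℚᵘ (+ 1) n)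

r𝒩 : ℕ → 𝒩
r𝒩 s i = [ s ] i

N𝒩 : ℕ → Pred 𝒩 0ℓ
N𝒩 s α = ∃ λ δ → Dist𝒩 (r𝒩 ([ s ] 0)) α δ × δ ℚ.< q ([ s ] 1)

------------------------------------------------------------------------
-- Borel codes

module _ (P : RecursivePresentation-ω×ω) where
  open RecursivePresentation-ω×ω P

  Nω×ω : ℕ → Pred (ℕ × ℕ) 0ℓ
  Nω×ω s x = d (r ([ s ] 0)) x <ʳ q ([ s ] 1)

  U : 𝒩 → Pred (ℕ × ℕ) 0ℓ
  U α x = ∃ λ k → Nω×ω (α k) x

  -- `Value α n β` says that {α}(n) is defined and equal to β.
  Value : 𝒩 → ℕ → Pred 𝒩 0ℓ
  Value α n β = Names β × (∀ γ → Names γ → γ ≗ β)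
    where
    Names : Pred 𝒩 0ℓ
    Names γ = ∀ s → N𝒩 s γ ⇔ U α (n , s)

  -- The recursion on ξ is well-founded, so its unique solution is the
  -- inductively generated one.
  data BC : ω₁ → Pred 𝒩 0ℓ where
    bc₀ : ∀ {ξ α} → ξ ≈ᵒ 0ᵒ → α 0 ≡ 0 → BC ξ α
    bc₊ : ∀ {ξ α} → 1ᵒ ≤ᵒ ξ → α 0 ≡ 1 →
          (∀ n → ∃ λ ζ → ζ <ᵒ ξ × ∃ λ β → Value (tail α) n β × BC ζ β) →
          BC ξ α

  -- Only the values at ξ ≥ 1 matter, here and in `IsApb`.
  IsRbc : (ω₁ → ω₁) → Set₁
  IsRbc rbc = ∀ ξ → 1ᵒ ≤ᵒ ξ → IsLeast (λ η → 1ᵒ ≤ᵒ η × Π⁰ η (BC ξ)) (rbc ξ)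

-- The ordinals whose supremum enters the recursion for apb(ξ).
ApbTerm : (rbc apb : ω₁ → ω₁) → ω₁ → Pred ω₁ 0ℓ
ApbTerm rbc apb ξ μ = ∃ λ η → 1ᵒ ≤ᵒ η × η <ᵒ ξ × IsMax (apb η) (sucᵒ (rbc η)) μ

record IsApb (rbc apb : ω₁ → ω₁) : Set where
  field
    apb-1  : ∀ ξ → ξ ≈ᵒ 1ᵒ → apb ξ ≈ᵒ 1ᵒ
    apb->1 : ∀ ξ → 1ᵒ <ᵒ ξ → ∃ λ σ → IsSup (ApbTerm rbc apb ξ) σ × apb ξ ≈ᵒ sucᵒ σ

{-# OPTIONS --safe #-}
module Submission where

-- The set of α for which {α}(n) is defined is Π⁰₂: the balls recorded by α at n must form the
-- neighbourhood filter of a point, which is a countable conjunction of implications between open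
-- conditions on α.  On this set {α}(n) depends continuously on α, so pulling back along it
-- preserves Borel classes.  Hence BC ξ is Π⁰ (ξ + 1) as soon as the union of the BC ζ with ζ < ξ
-- is, and that follows by induction: for a successor ξ = η + 1 the union is BC η up to the clopen
-- set BC 0, and for a limit ξ it is Σ⁰ ξ.

open import Defs
open import Axiom.ExcludedMiddle using (ExcludedMiddle)
open import Data.Integer.Base as ℤ using (+_)
import Data.Integer.Properties as ℤₚ
open import Data.List.Base using (List; []; _∷_)
open import Data.Nat.Base
  using (ℕ; zero; suc; _*_; _^_; _≤_; _<_; _⊔_; s<s; s<s⁻¹; >-nonZero)
open import Data.Nat.Divisibility using (_∣_; m∣m*n; ∣1⇒≡1; ∣-trans)
open import Data.Nat.Primality using (Prime; euclidsLemma; prime⇒irreducible; ¬prime[1])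
import Data.Nat.Properties as ℕₚ
open import Data.Product.Base using (∃; ∃₂; _×_; _,_; proj₁; proj₂)
open import Data.Rational.Unnormalised.Base as ℚ using (ℚᵘ; mkℚᵘ; 0ℚᵘ)
import Data.Rational.Unnormalised.Properties as ℚₚ
open import Data.Sum.Base using (_⊎_; inj₁; inj₂)
open import Function.Base using (_∘_; id)
open import Function.Bundles using (_⇔_; mk⇔; Equivalence)
open import Induction.WellFounded using (Acc; acc; WellFounded)
open import Level using (Level; 0ℓ; Lift; lift; lower) renaming (suc to lsuc)
open import Relation.Binary.Definitions using (tri<; tri≈; tri>)
open import Relation.Binary.PropositionalEquality
  using (_≡_; _≢_; _≗_; refl; sym; trans; cong; cong₂; subst; subst₂)
open import Relation.Nullary using (¬_; Dec; yes; no; contradiction)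
open import Relation.Nullary.Decidable using (decidable-stable; map′)
open import Relation.Unary using (Pred; ∁; _⊆_; _≐_; _∩_; _∪_; _∖_; ⋃; ⋂; ∅)
  renaming (U to 𝕌)

open Equivalence using (to; from)

private variable
  ℓ : Level
  ξ η ζ : ω₁
  A B C : Pred 𝒩 0ℓ

-- Countable ordinals

≤ᵒ-refl : ξ ≤ᵒ ξ
≤ᵒ-refl {0ᵒ}     = 0≤
≤ᵒ-refl {lsup f} = lsup≤ λ n → <lsup n ≤ᵒ-refl

≤ᵒ-trans : ξ ≤ᵒ η → η ≤ᵒ ζ → ξ ≤ᵒ ζ
<-≤ᵒ-trans : ξ <ᵒ η → η ≤ᵒ ζ → ξ <ᵒ ζ
≤-<ᵒ-trans : ξ ≤ᵒ η → η <ᵒ ζ → ξ <ᵒ ζ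
≤ᵒ-trans 0≤        _ = 0≤
≤ᵒ-trans (lsup≤ h) r = lsup≤ λ n → <-≤ᵒ-trans (h n) r
<-≤ᵒ-trans (<lsup n p) (lsup≤ h) = ≤-<ᵒ-trans p (h n)
≤-<ᵒ-trans p (<lsup n r) = <lsup n (≤ᵒ-trans p r)

<ᵒ⇒≤ᵒ : ξ <ᵒ η → ξ ≤ᵒ η
<ᵒ⇒≤ᵒ (<lsup n 0≤)        = 0≤
<ᵒ⇒≤ᵒ (<lsup n (lsup≤ h)) = lsup≤ λ k → <lsup n (<ᵒ⇒≤ᵒ (h k))

<ᵒsuc : ξ <ᵒ sucᵒ ξ
<ᵒsuc = <lsup 0 ≤ᵒ-refl

<ᵒ⇒suc≤ᵒ : ξ <ᵒ η → sucᵒ ξ ≤ᵒ η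
<ᵒ⇒suc≤ᵒ p = lsup≤ λ _ → p

≤ᵒ⇒<ᵒsuc : ξ ≤ᵒ η → ξ <ᵒ sucᵒ η
≤ᵒ⇒<ᵒsuc = <lsup 0

suc-mono-≤ᵒ : ξ ≤ᵒ η → sucᵒ ξ ≤ᵒ sucᵒ η
suc-mono-≤ᵒ p = <ᵒ⇒suc≤ᵒ (≤ᵒ⇒<ᵒsuc p)

1≤lsup : ∀ {f} → 1ᵒ ≤ᵒ lsup f
1≤lsup = <ᵒ⇒suc≤ᵒ (<lsup 0 0≤)

1≰0 : ¬ 1ᵒ ≤ᵒ 0ᵒ
1≰0 (lsup≤ h) with () ← h 0

1≮1 : ¬ 1ᵒ <ᵒ 1ᵒ
1≮1 (<lsup _ p) = 1≰0 p

≈ᵒ-trans : ξ ≈ᵒ η → η ≈ᵒ ζ → ξ ≈ᵒ ζ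
≈ᵒ-trans (a , b) (c , d) = ≤ᵒ-trans a c , ≤ᵒ-trans d b

≈ᵒ-sym : ξ ≈ᵒ η → η ≈ᵒ ξ
≈ᵒ-sym (a , b) = b , a

-- The recursion is structural in an upper bound `ξ`: an ordinal below `lsup f` is bounded by some
-- `f n`.
<ᵒ-wellFounded : WellFounded _<ᵒ_
<ᵒ-wellFounded ξ = below ξ ξ ≤ᵒ-refl
  where
  below : ∀ ξ η → η ≤ᵒ ξ → Acc _<ᵒ_ η
  step : ∀ ξ {ζ} → ζ <ᵒ ξ → Acc _<ᵒ_ ζ
  below ξ η η≤ξ = acc λ ζ<η → step ξ (<-≤ᵒ-trans ζ<η η≤ξ)
  step (lsup f) (<lsup n ζ≤fn) = below (f n) _ ζ≤fn

module Classical (em₁ : ExcludedMiddle (lsuc 0ℓ)) where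

  em : ExcludedMiddle 0ℓ
  em = map′ lower lift (em₁ {Lift _ _})

  -- Either `η` is at most some value of `f`, or by recursion every value of `f` lies below `η`.
  ≤ᵒ-or-> : ∀ ξ η → ξ ≤ᵒ η ⊎ η <ᵒ ξ
  ≤ᵒ-or-> 0ᵒ       η = inj₁ 0≤
  ≤ᵒ-or-> (lsup f) η with em {∃ λ n → η ≤ᵒ f n}
  ... | yes (n , p) = inj₂ (<lsup n p)
  ... | no  none    = inj₁ (lsup≤ λ n → below n (≤ᵒ-or-> η (f n)))
    where
    below : ∀ n → η ≤ᵒ f n ⊎ f n <ᵒ η → f n <ᵒ η
    below n (inj₁ p) = contradiction (n , p) none
    below n (inj₂ p) = p

  least : ExcludedMiddle ℓ → (Q : Pred ω₁ ℓ) → ∃ Q → ∃ (IsLeast Q)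
  least em′ Q (η , qη) = go η qη (<ᵒ-wellFounded η)
    where
    go : ∀ η → Q η → Acc _<ᵒ_ η → ∃ (IsLeast Q)
    go η qη (acc rs) with em′ {∃ λ ζ → ζ <ᵒ η × Q ζ}
    ... | yes (ζ , ζ<η , qζ) = go ζ qζ (rs ζ<η)
    ... | no  none = η , qη , λ ζ qζ → minimal ζ qζ (≤ᵒ-or-> η ζ)
      where
      minimal : ∀ ζ → Q ζ → η ≤ᵒ ζ ⊎ ζ <ᵒ η → η ≤ᵒ ζ
      minimal ζ qζ (inj₁ p) = p
      minimal ζ qζ (inj₂ p) = contradiction (ζ , p , qζ) none

  -- Since `lsup` is a strict bound, suprema are obtained as least upper bounds by minimisation;
  -- `lsup f` shows that an upper bound exists.
  module _ (f : ℕ → ω₁) where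
    private
      lub = least em (λ τ → ∀ n → f n ≤ᵒ τ) (lsup f , λ n → <ᵒ⇒≤ᵒ (<lsup n ≤ᵒ-refl))

    sup : ω₁
    sup = proj₁ lub

    ≤sup : ∀ n → f n ≤ᵒ sup
    ≤sup = proj₁ (proj₂ lub)

    sup≤ : ∀ {τ} → (∀ n → f n ≤ᵒ τ) → sup ≤ᵒ τ
    sup≤ = proj₂ (proj₂ lub) _

  max : ∀ ξ η → ∃ (IsMax ξ η)
  max ξ η with ≤ᵒ-or-> ξ η
  ... | inj₁ ξ≤η = η , inj₂ (ξ≤η , ≤ᵒ-refl , ≤ᵒ-refl)
  ... | inj₂ η<ξ = ξ , inj₁ (<ᵒ⇒≤ᵒ η<ξ , ≤ᵒ-refl , ≤ᵒ-refl)

IsMax⇒≤ : ∀ {ξ η μ τ} → IsMax ξ η μ → ξ ≤ᵒ τ → η ≤ᵒ τ → μ ≤ᵒ τ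
IsMax⇒≤ (inj₁ (_ , μ≈ξ)) ξ≤τ _ = ≤ᵒ-trans (proj₁ μ≈ξ) ξ≤τ
IsMax⇒≤ (inj₂ (_ , μ≈η)) _ η≤τ = ≤ᵒ-trans (proj₁ μ≈η) η≤τ

IsMax⇒≥ˡ : ∀ {ξ η μ} → IsMax ξ η μ → ξ ≤ᵒ μ
IsMax⇒≥ˡ (inj₁ (_ , μ≈ξ)) = proj₂ μ≈ξ
IsMax⇒≥ˡ (inj₂ (ξ≤η , μ≈η)) = ≤ᵒ-trans ξ≤η (proj₂ μ≈η)

IsMax⇒≥ʳ : ∀ {ξ η μ} → IsMax ξ η μ → η ≤ᵒ μ
IsMax⇒≥ʳ (inj₁ (η≤ξ , μ≈ξ)) = ≤ᵒ-trans η≤ξ (proj₂ μ≈ξ)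
IsMax⇒≥ʳ (inj₂ (_ , μ≈η)) = proj₂ μ≈η

-- Coding of finite sequences

prime-∣-prime : ∀ {p r} → Prime p → Prime r → p ∣ r → p ≡ r
prime-∣-prime pp pr p∣r with prime⇒irreducible pr p∣r
... | inj₁ refl = contradiction pp ¬prime[1]
... | inj₂ p≡r  = p≡r

prime-∣-^ : ∀ {p} m n → Prime p → p ∣ m ^ n → p ∣ m
prime-∣-^ m zero    pp p∣1 = contradiction (subst Prime (∣1⇒≡1 p∣1) pp) ¬prime[1]
prime-∣-^ m (suc n) pp p∣  with euclidsLemma m (m ^ n) pp p∣
... | inj₁ p∣m = p∣m
... | inj₂ p∣r = prime-∣-^ m n pp p∣r

prime#-<-suc : ∀ i → prime# i < prime# (suc i)
prime#-<-suc i = proj₁ (proj₁ (proj₂ (next-prime (prime# i))))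

prime#-mono-< : ∀ {i j} → i < j → prime# i < prime# j
prime#-mono-< {i} {suc j} i<1+j with ℕₚ.m<1+n⇒m<n∨m≡n i<1+j
... | inj₁ i<j  = ℕₚ.<-trans (prime#-mono-< i<j) (prime#-<-suc j)
... | inj₂ refl = prime#-<-suc j

prime#∤codeFrom : ∀ {j k} us → j < k → ¬ prime# j ∣ codeFrom k us
prime#∤codeFrom {j} [] j<k p∣1 =
  contradiction (subst Prime (∣1⇒≡1 p∣1) (prime#-prime j)) ¬prime[1]
prime#∤codeFrom {j} {k} (u ∷ us) j<k p∣
  with euclidsLemma (prime# k ^ suc u) _ (prime#-prime j) p∣
... | inj₁ p∣^ = ℕₚ.<⇒≢ (prime#-mono-< j<k)
  (prime-∣-prime (prime#-prime j) (prime#-prime k) (prime-∣-^ (prime# k) (suc u) (prime#-prime j) p∣^))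
... | inj₂ p∣c = prime#∤codeFrom us (ℕₚ.m<n⇒m<1+n j<k) p∣c

-- After cancelling common factors `p` one exponent is zero; the other must be zero too, as `p`
-- divides neither cofactor.
^*-injective : ∀ {p} u v {x y} → 0 < p → ¬ p ∣ x → ¬ p ∣ y →
               p ^ u * x ≡ p ^ v * y → u ≡ v × x ≡ y
^*-injective zero zero _ _ _ eq =
  refl , trans (sym (ℕₚ.*-identityˡ _)) (trans eq (ℕₚ.*-identityˡ _))
^*-injective {p} zero (suc v) {x} {y} _ p∤x _ eq = contradiction
  (subst (p ∣_) (trans (sym (ℕₚ.*-assoc p (p ^ v) y)) (trans (sym eq) (ℕₚ.*-identityˡ x))) (m∣m*n _)) p∤x
^*-injective {p} (suc u) zero {x} {y} _ _ p∤y eq = contradiction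
  (subst (p ∣_) (trans (sym (ℕₚ.*-assoc p (p ^ u) x)) (trans eq (ℕₚ.*-identityˡ y))) (m∣m*n _)) p∤y
^*-injective {p} (suc u) (suc v) {x} {y} 0<p p∤x p∤y eq
  with ^*-injective u v 0<p p∤x p∤y (ℕₚ.*-cancelˡ-≡ _ _ p {{>-nonZero 0<p}}
         (trans (sym (ℕₚ.*-assoc p (p ^ u) x)) (trans eq (ℕₚ.*-assoc p (p ^ v) y))))
... | u≡v , x≡y = cong suc u≡v , x≡y

1≢codeFrom-∷ : ∀ j u us → 1 ≢ codeFrom j (u ∷ us)
1≢codeFrom-∷ j u us eq = contradiction
  (subst Prime (∣1⇒≡1 (subst (prime# j ∣_) (sym eq) (∣-trans (m∣m*n (prime# j ^ u)) (m∣m*n _))))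
    (prime#-prime j))
  ¬prime[1]

-- The code of the rest uses only primes after `prime# j`, so the exponent of `prime# j` determines
-- the head.
codeFrom-injective : ∀ j us vs → codeFrom j us ≡ codeFrom j vs → us ≡ vs
codeFrom-injective j []       []       _  = refl
codeFrom-injective j []       (v ∷ vs) eq = contradiction eq (1≢codeFrom-∷ j v vs)
codeFrom-injective j (u ∷ us) []       eq = contradiction (sym eq) (1≢codeFrom-∷ j u us)
codeFrom-injective j (u ∷ us) (v ∷ vs) eq
  with ^*-injective (suc u) (suc v) (ℕₚ.<-trans ℕₚ.0<1+n (1<prime# j))
         (prime#∤codeFrom us (ℕₚ.n<1+n j)) (prime#∤codeFrom vs (ℕₚ.n<1+n j)) eq
... | u≡v , eq′ = cong₂ _∷_ (ℕₚ.suc-injective u≡v) (codeFrom-injective (suc j) us vs eq′)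

[⟨⟩]≡entry : ∀ us i → [ ⟨ us ⟩ ] i ≡ entry us i
[⟨⟩]≡entry us i with codeFrom? 0 ⟨ us ⟩
... | yes (vs , eq) = cong (λ ws → entry ws i) (codeFrom-injective 0 vs us eq)
... | no  none      = contradiction (us , refl) none

-- Balls in Baire space

1/suc : ℕ → ℚᵘ
1/suc n = mkℚᵘ (+ 1) n

1/suc-anti-< : ∀ {m n} → m < n → 1/suc n ℚ.< 1/suc m
1/suc-anti-< m<n = ℚ.*<* (subst₂ ℤ._<_ (sym (ℤₚ.*-identityˡ _)) (sym (ℤₚ.*-identityˡ _)) (ℤ.+<+ (s<s m<n)))

1/suc-anti-<⁻¹ : ∀ {m n} → 1/suc n ℚ.< 1/suc m → m < n
1/suc-anti-<⁻¹ (ℚ.*<* lt) =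
  s<s⁻¹ (ℤₚ.drop‿+<+ (subst₂ ℤ._<_ (ℤₚ.*-identityˡ _) (ℤₚ.*-identityˡ _) lt))

0<1/suc : ∀ n → 0ℚᵘ ℚ.< 1/suc n
0<1/suc n = ℚₚ.positive⁻¹ (1/suc n)

1/suc<positive : ∀ ρ → 0ℚᵘ ℚ.< ρ → ∃ λ m → 1/suc m ℚ.< ρ
1/suc<positive (mkℚᵘ (+ zero) b) (ℚ.*<* (ℤ.+<+ ()))
-- The witness yields 1/(b+2), which is less than 1/(b+1) and so less than (a+1)/(b+1).
1/suc<positive (mkℚᵘ ℤ.+[1+ a ] b) _ = suc b , ℚ.*<* (ℤ.+<+ (ℕₚ.≤-trans
  (ℕₚ.≤-reflexive (cong suc (ℕₚ.+-identityʳ (suc b)))) (ℕₚ.m≤m+n (suc (suc b)) _)))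
1/suc<positive (mkℚᵘ ℤ.-[1+ a ] b) (ℚ.*<* ())

Agree-sym : ∀ {m α β} → Agree m α β → Agree m β α
Agree-sym h i i<m = sym (h i i<m)

Agree-trans : ∀ {m α β γ} → Agree m α β → Agree m β γ → Agree m α γ
Agree-trans h h′ i i<m = trans (h i i<m) (h′ i i<m)

Agree-≤ : ∀ {m n α β} → m ≤ n → Agree n α β → Agree m α β
Agree-≤ m≤n h i i<m = h i (ℕₚ.<-≤-trans i<m m≤n)

Dist𝒩⇒0≤ : ∀ {α β δ} → Dist𝒩 α β δ → 0ℚᵘ ℚ.≤ δ
Dist𝒩⇒0≤ (equal _)      = ℚₚ.≤-refl
Dist𝒩⇒0≤ (differ n _ _) = ℚₚ.<⇒≤ (0<1/suc n)

-- The distance depends only on the first difference, which for `β` and `γ` alike is at `n`.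
Dist𝒩-local : ∀ {α β γ δ} n → Agree n α β → α n ≢ β n → Agree (suc n) β γ →
              Dist𝒩 α γ δ → Dist𝒩 α β δ
Dist𝒩-local n αβ α≢β βγ (equal α≗γ) =
  contradiction (trans (α≗γ n) (sym (βγ n (ℕₚ.n<1+n n)))) α≢β
Dist𝒩-local n αβ α≢β βγ (differ k αγ α≢γ) with ℕₚ.<-cmp k n
... | tri< k<n _ _  = contradiction (trans (αβ k k<n) (βγ k (ℕₚ.m<n⇒m<1+n k<n))) α≢γ
... | tri≈ _ refl _ = differ n αβ α≢β
... | tri> _ _ n<k  = contradiction (trans (αγ n n<k) (sym (βγ n (ℕₚ.n<1+n n)))) α≢β

prefix : ℕ → 𝒩 → List ℕ
prefix zero    α = []
prefix (suc m) α = α 0 ∷ prefix m (tail α)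

entry-prefix : ∀ m α → Agree m (entry (prefix m α)) α
entry-prefix (suc m) α zero    _   = refl
entry-prefix (suc m) α (suc i) i<m = entry-prefix m (tail α) i (s<s⁻¹ i<m)

-- This is clopenness: a finite prefix of each point settles membership nearby.
LocallyConstant : Pred 𝒩 0ℓ → Set
LocallyConstant A = ∀ α → ∃ λ m → ∀ β → Agree m α β → (A α → A β) × (A β → A α)

LocallyConstant⇒Open : ∀ {A} → LocallyConstant A → Open A
LocallyConstant⇒Open lc α a with lc α
... | m , h = m , λ β αβ → proj₁ (h β αβ) a

LocallyConstant⇒Open-∁ : ∀ {A} → LocallyConstant A → Open (∁ A)
LocallyConstant⇒Open-∁ lc α ¬a with lc α
... | m , h = m , λ β αβ a → ¬a (proj₂ (h β αβ) a)

module Baire (em₁ : ExcludedMiddle (lsuc 0ℓ)) where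
  open Classical em₁

  equal-or-differ : ∀ α β → α ≗ β ⊎ ∃ λ n → Agree n α β × α n ≢ β n
  equal-or-differ α β with em {∃ λ n → α n ≢ β n}
  ... | no  none    = inj₁ λ n → decide n
    where
    decide : ∀ n → α n ≡ β n
    decide n with α n ℕₚ.≟ β n
    ... | yes eq = eq
    ... | no  ne = contradiction (n , ne) none
  ... | yes (n , ne) with ∃-least {λ k → α k ≢ β k} (λ _ → em) n ne
  ... | k , ne′ , minimal = inj₂ (k , agree , ne′)
    where
    agree : Agree k α β
    agree i i<k with α i ℕₚ.≟ β i
    ... | yes eq = eq
    ... | no  ne = contradiction ne (minimal i i<k)

  ball : 𝒩 → ℚᵘ → Pred 𝒩 0ℓ
  ball α ρ β = ∃ λ δ → Dist𝒩 α β δ × δ ℚ.< ρ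

  ∈ball : ∀ {α β} m {ρ} → Agree m α β → 1/suc m ℚ.< ρ → ball α ρ β
  ∈ball {α} {β} m αβ 1/m<ρ with equal-or-differ α β
  ... | inj₁ α≗β            = 0ℚᵘ , equal α≗β , ℚₚ.<-trans (0<1/suc m) 1/m<ρ
  ... | inj₂ (n , αβ′ , ne) = 1/suc n , differ n αβ′ ne , small (ℕₚ.<-cmp m n)
    where
    small : _ → 1/suc n ℚ.< _
    small (tri< m<n _ _)  = ℚₚ.<-trans (1/suc-anti-< m<n) 1/m<ρ
    small (tri≈ _ refl _) = 1/m<ρ
    small (tri> _ _ n<m)  = contradiction (αβ n n<m) ne

  -- Away from the centre, the prefix through the first difference fixes the distance. At the
  -- centre, either the ball is empty or it contains every point that agrees far enough.
  ball-locallyConstant : ∀ α ρ → LocallyConstant (ball α ρ)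
  ball-locallyConstant α ρ β with equal-or-differ α β
  ... | inj₂ (n , αβ , ne) = suc n , λ γ βγ →
    (λ (δ , D , δ<ρ) → δ , Dist𝒩-local n (Agree-trans αβ (Agree-≤ (ℕₚ.n≤1+n n) βγ))
                         (λ eq → ne (trans eq (sym (βγ n (ℕₚ.n<1+n n))))) (Agree-sym βγ) D , δ<ρ) ,
    (λ (δ , D , δ<ρ) → δ , Dist𝒩-local n αβ ne βγ D , δ<ρ)
  ... | inj₁ α≗β with 0ℚᵘ ℚₚ.<? ρ
  ...   | no  ρ≤0 = 0 , λ γ _ → (λ b → contradiction (positive b) ρ≤0) , (λ b → contradiction (positive b) ρ≤0)
    where
    positive : ∀ {γ} → ball α ρ γ → 0ℚᵘ ℚ.< ρ
    positive (δ , D , δ<ρ) = ℚₚ.≤-<-trans (Dist𝒩⇒0≤ D) δ<ρ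
  ...   | yes 0<ρ with 1/suc<positive ρ 0<ρ
  ...     | m , 1/m<ρ = m , λ γ βγ →
    (λ _ → ∈ball m (λ i i<m → trans (α≗β i) (βγ i i<m)) 1/m<ρ) ,
    (λ _ → 0ℚᵘ , equal α≗β , 0<ρ)

  N𝒩-locallyConstant : ∀ s → LocallyConstant (N𝒩 s)
  N𝒩-locallyConstant s = ball-locallyConstant (r𝒩 ([ s ] 0)) (q ([ s ] 1))

  N𝒩-basis : ∀ β m → ∃ λ s → N𝒩 s β × (∀ γ → N𝒩 s γ → Agree m β γ)
  N𝒩-basis β m = s , subst₂ (λ a ρ → ball (r𝒩 a) ρ β) (sym centre) (sym radius) β∈ , N⊆
    where
    -- The radius is 1/(m+1). Agreement on only `m` entries would allow exactly that distance, so
    -- the centre copies one entry more to have `β` strictly inside.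
    u = ⟨ prefix (suc m) β ⟩
    v = ⟨ 1 ∷ m ∷ [] ⟩
    s = ⟨ u ∷ v ∷ [] ⟩

    centre : [ s ] 0 ≡ u
    centre = [⟨⟩]≡entry (u ∷ v ∷ []) 0

    radius : q ([ s ] 1) ≡ 1/suc m
    radius = trans (cong q ([⟨⟩]≡entry (u ∷ v ∷ []) 1))
      (cong₂ (λ a b → mkℚᵘ (+ a) b) ([⟨⟩]≡entry (1 ∷ m ∷ []) 0) ([⟨⟩]≡entry (1 ∷ m ∷ []) 1))

    uβ : Agree (suc m) (r𝒩 u) β
    uβ i i≤m = trans ([⟨⟩]≡entry (prefix (suc m) β) i) (entry-prefix (suc m) β i i≤m)

    β∈ : ball (r𝒩 u) (1/suc m) β
    β∈ = ∈ball (suc m) uβ (1/suc-anti-< (ℕₚ.n<1+n m))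

    uγ : ∀ {γ} → ball (r𝒩 u) (1/suc m) γ → Agree m (r𝒩 u) γ
    uγ (_ , equal u≗γ , _)      i _   = u≗γ i
    uγ (_ , differ n uγ _ , lt) i i<m = uγ i (ℕₚ.<-trans i<m (1/suc-anti-<⁻¹ lt))

    N⊆ : ∀ γ → N𝒩 s γ → Agree m β γ
    N⊆ γ γ∈ = Agree-trans (Agree-sym (Agree-≤ (ℕₚ.n≤1+n m) uβ))
                (uγ (subst₂ (λ a ρ → ball (r𝒩 a) ρ γ) centre radius γ∈))

  N𝒩-inside : ∀ {A} → Open A → ∀ β → A β → ∃ λ s → N𝒩 s β × N𝒩 s ⊆ A
  N𝒩-inside open-A β a with open-A β a
  ... | m , h with N𝒩-basis β m
  ... | s , β∈ , N⊆ = s , β∈ , λ {γ} γ∈ → h γ (N⊆ γ γ∈)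

-- Closure properties of the Borel classes

≐-trans : A ≐ B → B ≐ C → A ≐ C
≐-trans (f , g) (h , k) = h ∘ f , g ∘ k

Σ⁰-resp-≐ : A ≐ B → Σ⁰ ξ B → Σ⁰ ξ A
Σ⁰-resp-≐ (f , g) (isOpen ξ≈1 open-B) = isOpen ξ≈1 λ α a →
  let m , h = open-B α (f a) in m , λ β αβ → g (h β αβ)
Σ⁰-resp-≐ A≐B (isUnion 1<ξ ζ C h B≐) = isUnion 1<ξ ζ C h (≐-trans A≐B B≐)

Π⁰-resp-≐ : A ≐ B → Π⁰ ξ B → Π⁰ ξ A
Π⁰-resp-≐ A≐B (isComplement C s B≐) = isComplement C s (≐-trans A≐B B≐)

Open-∩ : Open A → Open B → Open (A ∩ B)
Open-∩ open-A open-B α (a , b) with open-A α a | open-B α b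
... | m , h | n , k = m ⊔ n , λ β αβ →
  h β (Agree-≤ (ℕₚ.m≤m⊔n m n) αβ) , k β (Agree-≤ (ℕₚ.m≤n⊔m m n) αβ)

Open-× : ∀ (X : Set) → Open A → Open (λ α → A α × X)
Open-× X open-A α (a , x) = let m , h = open-A α a in m , λ β αβ → h β αβ , x

Open-⋃ : ∀ {I : Set} {A : I → Pred 𝒩 0ℓ} → (∀ i → Open (A i)) → Open (⋃ I A)
Open-⋃ open-A α (i , a) with open-A i α a
... | m , h = m , λ β αβ → i , h β αβ

Open-∅ : Open ∅
Open-∅ _ ()

Open-𝕌 : Open 𝕌
Open-𝕌 α _ = 0 , _

module Borel (em₁ : ExcludedMiddle (lsuc 0ℓ)) where
  open Classical em₁
  open Baire em₁

  ∁∁ : A ≐ ∁ (∁ A)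
  ∁∁ = (λ a ¬a → ¬a a) , decidable-stable em

  ∁⁺ : Σ⁰ ξ A → Π⁰ ξ (∁ A)
  ∁⁺ s = isComplement _ s (id , id)

  closed⇒Π⁰ : ξ ≈ᵒ 1ᵒ → Open (∁ A) → Π⁰ ξ A
  closed⇒Π⁰ ξ≈1 open-∁A = isComplement _ (isOpen ξ≈1 open-∁A) ∁∁

  -- An open set is the union of the clopen balls N𝒩 s it contains.
  ∖⇒Σ⁰ : 1ᵒ <ᵒ ξ → Open A → Open B → Σ⁰ ξ (A ∖ B)
  ∖⇒Σ⁰ {A = A} {B = B} 1<ξ open-A open-B = isUnion 1<ξ (λ _ → 1ᵒ) piece
    (λ s → ≤ᵒ-refl , 1<ξ , closed⇒Π⁰ (≤ᵒ-refl , ≤ᵒ-refl) (open-∁piece s))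
    ((λ {α} (a , ¬b) → let s , α∈ , N⊆ = N𝒩-inside open-A α a in s , N⊆ , α∈ , ¬b) ,
     (λ (s , N⊆ , α∈ , ¬b) → N⊆ α∈ , ¬b))
    where
    piece : ℕ → Pred 𝒩 0ℓ
    -- The inclusion does not mention `α`; a ball that is not inside `A` contributes an empty piece.
    piece s α = N𝒩 s ⊆ A × N𝒩 s α × ¬ B α

    open-∁piece : ∀ s → Open (∁ (piece s))
    open-∁piece s α ¬p with em {N𝒩 s ⊆ A}
    ... | no  N⊈A = 0 , λ _ _ (N⊆A , _) → N⊈A N⊆A
    ... | yes N⊆A with em {B α}
    ...   | yes b = let m , h = open-B α b in m , λ β αβ (_ , _ , ¬b) → ¬b (h β αβ)
    ...   | no ¬b = let m , h = LocallyConstant⇒Open-∁ (N𝒩-locallyConstant s) α (λ α∈ → ¬p (N⊆A , α∈ , ¬b))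
                    in m , λ β αβ (_ , β∈ , _) → h β αβ β∈

  implication⇒Π⁰ : 1ᵒ <ᵒ ξ → Open A → Open B → Π⁰ ξ (λ α → A α → B α)
  implication⇒Π⁰ 1<ξ open-A open-B = isComplement _ (∖⇒Σ⁰ 1<ξ open-A open-B)
    ( (λ h (a , ¬b) → ¬b (h a))
    , (λ h a → decidable-stable em λ ¬b → h (a , ¬b)))

  Σ⁰⇒1≤ : Σ⁰ ξ A → 1ᵒ ≤ᵒ ξ
  Σ⁰⇒1≤ (isOpen ξ≈1 _)        = proj₂ ξ≈1
  Σ⁰⇒1≤ (isUnion 1<ξ _ _ _ _) = <ᵒ⇒≤ᵒ 1<ξ

  -- Above index 1 an open set must be exhibited as a union; it is the difference of itself and the
  -- empty set.
  open⇒Σ⁰ : 1ᵒ ≤ᵒ ξ → Open A → Σ⁰ ξ A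
  open⇒Σ⁰ {ξ} 1≤ξ open-A with ≤ᵒ-or-> ξ 1ᵒ
  ... | inj₁ ξ≤1 = isOpen (ξ≤1 , 1≤ξ) open-A
  ... | inj₂ 1<ξ = Σ⁰-resp-≐ ((λ a → a , λ ()) , proj₁) (∖⇒Σ⁰ 1<ξ open-A Open-∅)

  Σ⁰-mono : ξ ≤ᵒ η → Σ⁰ ξ A → Σ⁰ η A
  Σ⁰-mono ξ≤η (isOpen ξ≈1 open-A) = open⇒Σ⁰ (≤ᵒ-trans (proj₂ ξ≈1) ξ≤η) open-A
  Σ⁰-mono ξ≤η (isUnion 1<ξ ζ B h A≐) = isUnion (<-≤ᵒ-trans 1<ξ ξ≤η) ζ B
    (λ n → let a , b , c = h n in a , <-≤ᵒ-trans b ξ≤η , c) A≐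

  Π⁰-mono : ξ ≤ᵒ η → Π⁰ ξ A → Π⁰ η A
  Π⁰-mono ξ≤η (isComplement B s A≐) = isComplement B (Σ⁰-mono ξ≤η s) A≐

  Π⁰⇒Σ⁰ : 1ᵒ ≤ᵒ ξ → ξ <ᵒ η → Π⁰ ξ A → Σ⁰ η A
  Π⁰⇒Σ⁰ 1≤ξ ξ<η p = isUnion (≤-<ᵒ-trans 1≤ξ ξ<η) _ _ (λ _ → 1≤ξ , ξ<η , p) ((0 ,_) , proj₂)

  Σ⁰⇒Π⁰ : ξ <ᵒ η → Σ⁰ ξ A → Π⁰ η A
  Σ⁰⇒Π⁰ ξ<η s = isComplement _ (Π⁰⇒Σ⁰ (Σ⁰⇒1≤ s) ξ<η (∁⁺ s)) ∁∁

  Σ⁰-1⇒Open : ξ ≤ᵒ 1ᵒ → Σ⁰ ξ A → Open A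
  Σ⁰-1⇒Open _   (isOpen _ open-A)      = open-A
  Σ⁰-1⇒Open ξ≤1 (isUnion 1<ξ _ _ _ _) = contradiction (<-≤ᵒ-trans 1<ξ ξ≤1) 1≮1

  Σ⁰⇒union : 1ᵒ <ᵒ ξ → Σ⁰ ξ A → ∃₂ λ (ζ : ℕ → ω₁) (B : ℕ → Pred 𝒩 0ℓ) →
             (∀ n → 1ᵒ ≤ᵒ ζ n × ζ n <ᵒ ξ × Π⁰ (ζ n) (B n)) × A ≐ ⋃ ℕ B
  Σ⁰⇒union 1<ξ (isOpen ξ≈1 _)      = contradiction (<-≤ᵒ-trans 1<ξ (proj₁ ξ≈1)) 1≮1
  Σ⁰⇒union _   (isUnion _ ζ B h A≐) = ζ , B , h , A≐

  -- Above index 1 the double union is flattened along codes of pairs. Numbers that are not such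
  -- codes still decode to some pair, so they only repeat members.
  Σ⁰-⋃ : {A : ℕ → Pred 𝒩 0ℓ} → (∀ n → Σ⁰ ξ (A n)) → Σ⁰ ξ (⋃ ℕ A)
  Σ⁰-⋃ {ξ} {A} h with ≤ᵒ-or-> ξ 1ᵒ
  ... | inj₁ ξ≤1 = isOpen (ξ≤1 , Σ⁰⇒1≤ (h 0)) (Open-⋃ λ n → Σ⁰-1⇒Open ξ≤1 (h n))
  ... | inj₂ 1<ξ = isUnion 1<ξ
    (λ s → κ ([ s ] 0) ([ s ] 1)) (λ s → D ([ s ] 0) ([ s ] 1)) (λ s → hB ([ s ] 0) ([ s ] 1))
    ((λ {α} (n , a) → let k , b = proj₁ (A≐ n) a in
       ⟨ n ∷ k ∷ [] ⟩ , subst₂ (λ n k → D n k α) (sym ([⟨⟩]≡entry (n ∷ k ∷ []) 0))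
                                                 (sym ([⟨⟩]≡entry (n ∷ k ∷ []) 1)) b) ,
     (λ (s , b) → [ s ] 0 , proj₂ (A≐ ([ s ] 0)) ([ s ] 1 , b)))
    where
    κ : ℕ → ℕ → ω₁
    κ n = proj₁ (Σ⁰⇒union 1<ξ (h n))
    D : ℕ → ℕ → Pred 𝒩 0ℓ
    D n = proj₁ (proj₂ (Σ⁰⇒union 1<ξ (h n)))
    hB : ∀ n k → 1ᵒ ≤ᵒ κ n k × κ n k <ᵒ ξ × Π⁰ (κ n k) (D n k)
    hB n = proj₁ (proj₂ (proj₂ (Σ⁰⇒union 1<ξ (h n))))
    A≐ : ∀ n → A n ≐ ⋃ ℕ (D n)
    A≐ n = proj₂ (proj₂ (proj₂ (Σ⁰⇒union 1<ξ (h n))))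

  Π⁰-⋂ : {A : ℕ → Pred 𝒩 0ℓ} → (∀ n → Π⁰ ξ (A n)) → Π⁰ ξ (⋂ ℕ A)
  Π⁰-⋂ h = isComplement _ (Σ⁰-⋃ λ n → proj₁ (proj₂ (complement (h n))))
    ( (λ a (n , b) → proj₁ (proj₂ (proj₂ (complement (h n)))) (a n) b)
    , (λ ¬b n → proj₂ (proj₂ (proj₂ (complement (h n)))) λ b → ¬b (n , b)))
    where
    complement : Π⁰ ξ A → ∃ λ B → Σ⁰ ξ B × A ≐ ∁ B
    complement (isComplement B s A≐) = B , s , A≐

  Π⁰-∩ : Π⁰ ξ A → Π⁰ ξ B → Π⁰ ξ (A ∩ B)
  Π⁰-∩ {ξ} {A} {B} a b = Π⁰-resp-≐
    ((λ { (x , y) zero → x ; (x , y) (suc _) → y }) , λ h → h 0 , h 1)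
    (Π⁰-⋂ {A = pair} λ { zero → a ; (suc _) → b })
    where
    pair : ℕ → Pred 𝒩 0ℓ
    pair zero    = A
    pair (suc _) = B

  LocallyConstant-∁ : LocallyConstant A → LocallyConstant (∁ A)
  LocallyConstant-∁ lc α = let m , h = lc α in m , λ β αβ →
    (λ ¬a b → ¬a (proj₂ (h β αβ) b)) , (λ ¬b a → ¬b (proj₁ (h β αβ) a))

  clopen⇒Π⁰ : 1ᵒ ≤ᵒ ξ → LocallyConstant A → Π⁰ ξ A
  clopen⇒Π⁰ 1≤ξ lc = isComplement _ (open⇒Σ⁰ 1≤ξ (LocallyConstant⇒Open-∁ lc)) ∁∁

  Σ⁰-∩-clopen : LocallyConstant C → Σ⁰ ξ A → Σ⁰ ξ (A ∩ C)
  Σ⁰-∩-clopen lc (isOpen ξ≈1 open-A) = isOpen ξ≈1 (Open-∩ open-A (LocallyConstant⇒Open lc))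
  Σ⁰-∩-clopen {C} lc (isUnion 1<ξ ζ B h A≐) = isUnion 1<ξ ζ (λ n → B n ∩ C)
    (λ n → let 1≤ζ , ζ<ξ , p = h n in 1≤ζ , ζ<ξ , Π⁰-∩ p (clopen⇒Π⁰ 1≤ζ lc))
    ( (λ (a , c) → let n , b = proj₁ A≐ a in n , b , c)
    , (λ (n , b , c) → proj₂ A≐ (n , b) , c))

  -- By De Morgan this amounts to intersecting a Σ⁰ set with a clopen set, which can be done
  -- termwise in its defining union.
  Π⁰-∪-clopen : LocallyConstant C → Π⁰ ξ A → Π⁰ ξ (A ∪ C)
  Π⁰-∪-clopen {C} {A = A} lc (isComplement B s A≐) =
    isComplement (B ∩ ∁ C) (Σ⁰-∩-clopen (LocallyConstant-∁ lc) s)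
      ( (λ { (inj₁ a) (b , _) → proj₁ A≐ a b ; (inj₂ c) (_ , ¬c) → ¬c c })
      , λ h → either h em)
    where
    either : ∀ {α} → ¬ (B α × ¬ C α) → Dec (C α) → A α ⊎ C α
    either h (yes c) = inj₂ c
    either h (no ¬c) = inj₁ (proj₂ A≐ λ b → h (b , ¬c))

-- Borel codes

module Codes (em₁ : ExcludedMiddle (lsuc 0ℓ)) (P : RecursivePresentation-ω×ω) where
  open Classical em₁
  open Baire em₁
  open Borel em₁

  Contains : ℕ → ℕ → Pred 𝒩 0ℓ
  Contains n s α = U P (tail α) (n , s)

  Open-Contains : ∀ n s → Open (Contains n s)
  -- The witnessing entry of `tail α` at `k` is entry k+1 of `α`, hence a prefix of length k+2.
  Open-Contains n s α (k , c) = suc (suc k) , λ β αβ →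
    k , subst (λ a → Nω×ω P a (n , s)) (αβ (suc k) (ℕₚ.n<1+n (suc k))) c

  Names : 𝒩 → ℕ → Pred 𝒩 0ℓ
  Names α n β = ∀ s → N𝒩 s β ⇔ Contains n s α

  -- Both points lie in the same recorded balls, and small balls around `β` fix each entry. Hence
  -- the uniqueness clause of `Value` is automatic.
  Names-unique : ∀ {α n β γ} → Names α n β → Names α n γ → γ ≗ β
  Names-unique {β = β} {γ} nβ nγ i with N𝒩-basis β (suc i)
  ... | s , β∈ , N⊆ = sym (N⊆ γ (from (nγ s) (to (nβ s) β∈)) i (ℕₚ.n<1+n i))

  Names⇒Value : ∀ {α n β} → Names α n β → Value P (tail α) n β
  Names⇒Value {α} {n} nβ = nβ , λ γ nγ → Names-unique {α} {n} nβ nγ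

  Small : ℕ → ℕ → Set
  Small m s = ∀ β γ → N𝒩 s β → N𝒩 s γ → Agree m β γ

  Meet : ℕ → ℕ → Set
  Meet s t = ∃ λ γ → N𝒩 s γ × N𝒩 t γ

  -- The balls recorded by α form the neighbourhood filter of a point.  Every field is a countable
  -- conjunction of implications between open conditions on α, hence the shape of meet.
  record Domain (n : ℕ) (α : 𝒩) : Set where
    field
      small : ∀ m → ∃ λ s → Small m s × Contains n s α
      meet  : ∀ s t → Contains n s α × Contains n t α × ¬ Meet s t → ∅ α
      up    : ∀ s t → Contains n s α × N𝒩 s ⊆ N𝒩 t → Contains n t α

  Names⇒Domain : ∀ {α n β} → Names α n β → Domain n α
  Names⇒Domain {β = β} nβ = record
    { small = λ m → let s , β∈ , N⊆ = N𝒩-basis β m in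
        s , (λ γ δ γ∈ δ∈ → Agree-trans (Agree-sym (N⊆ γ γ∈)) (N⊆ δ δ∈)) , to (nβ s) β∈
    ; meet  = λ s t (cs , ct , disjoint) → disjoint (β , from (nβ s) cs , from (nβ t) ct)
    ; up    = λ s t (cs , N⊆) → to (nβ t) (N⊆ (from (nβ s) cs))
    }

  -- A completeness argument: the recorded balls contain arbitrarily small ones that pairwise meet,
  -- so their points converge. Entry `i` of the limit is read off a ball that decides the first i+1
  -- entries.
  Domain⇒Names : ∀ {α n} → Domain n α → ∃ (Names α n)
  Domain⇒Names {α} {n} D = β , λ t → mk⇔ (∈⇒contains t) (contains⇒∈ t)
    where
    open Domain D

    σ : ℕ → ℕ
    σ m = proj₁ (small m)

    contains-σ : ∀ m → Contains n (σ m) α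
    contains-σ m = proj₂ (proj₂ (small m))

    meets : ∀ {s t} → Contains n s α → Contains n t α → Meet s t
    meets cs ct = decidable-stable em λ disjoint → meet _ _ (cs , ct , disjoint)

    point : ℕ → 𝒩
    point m = proj₁ (meets (contains-σ m) (contains-σ m))

    point∈ : ∀ m → N𝒩 (σ m) (point m)
    point∈ m = proj₁ (proj₂ (meets (contains-σ m) (contains-σ m)))

    β : 𝒩
    β i = point (suc i) i

    near-β : ∀ m γ → N𝒩 (σ m) γ → Agree m γ β
    -- A common point of the two balls links `γ` to the point that defined entry `i`.
    near-β m γ γ∈ i i<m with meets (contains-σ m) (contains-σ (suc i))
    ... | δ , δ∈ , δ∈′ = trans (proj₁ (proj₂ (small m)) γ δ γ∈ δ∈ i i<m)
                               (proj₁ (proj₂ (small (suc i))) δ _ δ∈′ (point∈ (suc i)) i (ℕₚ.n<1+n i))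

    ∈⇒contains : ∀ t → N𝒩 t β → Contains n t α
    ∈⇒contains t β∈ with N𝒩-locallyConstant t β
    ... | m , h = up (σ m) t (contains-σ m , λ {γ} γ∈ → proj₁ (h γ (Agree-sym (near-β m γ γ∈))) β∈)

    contains⇒∈ : ∀ t → Contains n t α → N𝒩 t β
    contains⇒∈ t ct with N𝒩-locallyConstant t β
    ... | m , h with meets (contains-σ m) ct
    ... | γ , γ∈ , γ∈t = proj₂ (h γ (Agree-sym (near-β m γ γ∈))) γ∈t

  Domain-Π⁰ : 1ᵒ <ᵒ ξ → ∀ n → Π⁰ ξ (Domain n)
  Domain-Π⁰ 1<ξ n = Π⁰-resp-≐
    ( (λ D → (λ m _ → Domain.small D m) , Domain.meet D , Domain.up D)
    , (λ (s , m , u) → record { small = λ k → s k _ ; meet = m ; up = u }))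
    -- An open condition counts as an implication from the whole space, and the negation of one as
    -- an implication into the empty set.
    (Π⁰-∩ (Π⁰-⋂ λ m → implication⇒Π⁰ 1<ξ Open-𝕌
            (Open-⋃ λ s α (small , c) → let k , h = Open-Contains n s α c in k , λ β αβ → small , h β αβ))
    (Π⁰-∩ (Π⁰-⋂ λ s → Π⁰-⋂ λ t → implication⇒Π⁰ 1<ξ
             (Open-∩ (Open-Contains n s) (Open-× _ (Open-Contains n t))) Open-∅)
          (Π⁰-⋂ λ s → Π⁰-⋂ λ t → implication⇒Π⁰ 1<ξ
             (Open-× _ (Open-Contains n s)) (Open-Contains n t))))

  -- {α*}(n) depends continuously on α ∈ Domain n; A′ is only determined there.
  Pullback : ℕ → Pred 𝒩 0ℓ → Pred 𝒩 0ℓ → Set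
  Pullback n A A′ = ∀ α β → Names α n β → A β ⇔ A′ α

  -- Induction along the hierarchy. The named point lies in an open `A` exactly when some recorded
  -- ball is inside `A`, an open condition on `α`; unions and complements carry over.
  Σ⁰-pullback : ∀ n → Σ⁰ ξ A → ∃ λ A′ → Σ⁰ ξ A′ × Pullback n A A′
  Π⁰-pullback : ∀ n → Π⁰ ξ A → ∃ λ A′ → Π⁰ ξ A′ × Pullback n A A′
  Σ⁰-pullback {A = A} n (isOpen ξ≈1 open-A) =
    A′ , isOpen ξ≈1 (Open-⋃ λ s → Open-× _ (Open-Contains n s)) ,
    λ α β nβ → mk⇔ (forth α β nβ) (λ (s , c , N⊆) → N⊆ (from (nβ s) c))
    where
    A′ : Pred 𝒩 0ℓ
    A′ α = ∃ λ s → Contains n s α × N𝒩 s ⊆ A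

    forth : ∀ α β → Names α n β → A β → A′ α
    forth α β nβ a with N𝒩-inside open-A β a
    ... | s , β∈ , N⊆ = s , to (nβ s) β∈ , N⊆
  Σ⁰-pullback n (isUnion 1<ξ ζ B h A≐) =
    ⋃ ℕ (λ k → proj₁ (pull k)) ,
    isUnion 1<ξ ζ _ (λ k → proj₁ (h k) , proj₁ (proj₂ (h k)) , proj₁ (proj₂ (pull k))) (id , id) ,
    λ α β nβ → mk⇔
      (λ a → let k , b = proj₁ A≐ a in k , to (proj₂ (proj₂ (pull k)) α β nβ) b)
      (λ (k , b) → proj₂ A≐ (k , from (proj₂ (proj₂ (pull k)) α β nβ) b))
    where
    pull : ∀ k → ∃ λ B′ → Π⁰ (ζ k) B′ × Pullback n (B k) B′
    pull k = Π⁰-pullback n (proj₂ (proj₂ (h k)))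
  Π⁰-pullback n (isComplement B s A≐) = let B′ , s′ , p = Σ⁰-pullback n s in
    ∁ B′ , ∁⁺ s′ , λ α β nβ → mk⇔
      (λ a b′ → proj₁ A≐ a (from (p α β nβ) b′))
      (λ ¬b′ → proj₂ A≐ λ b → ¬b′ (to (p α β nβ) b))

  ValueIn : Pred 𝒩 0ℓ → ℕ → Pred 𝒩 0ℓ
  ValueIn A n α = ∃ λ β → Names α n β × A β

  -- The quantifier over points of Baire space disappears: having a value is membership in
  -- `Domain n`, and there the pullback tests whether that value is in `A`.
  Π⁰-ValueIn : 1ᵒ <ᵒ ξ → Π⁰ ξ A → ∀ n → Π⁰ ξ (ValueIn A n)
  Π⁰-ValueIn 1<ξ a n = let A′ , a′ , p = Π⁰-pullback n a in Π⁰-resp-≐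
    ( (λ (β , nβ , b) → Names⇒Domain nβ , to (p _ β nβ) b)
    , (λ (D , b) → let β , nβ = Domain⇒Names D in β , nβ , from (p _ β nβ) b))
    (Π⁰-∩ (Domain-Π⁰ 1<ξ n) a′)

  -- Codes of level 0 start with 0 and all others with 1, so the `BC` sets do not increase from
  -- level 0 on; adjoining level 0 makes the family increasing.
  BC∪BC₀ : ω₁ → Pred 𝒩 0ℓ
  BC∪BC₀ ξ = BC P ξ ∪ λ α → α 0 ≡ 0

  BC<_ : ω₁ → Pred 𝒩 0ℓ
  BC<_ ξ α = ∃ λ ζ → ζ <ᵒ ξ × BC P ζ α

  BC-mono : ∀ {α} → ξ ≤ᵒ η → BC P ξ α → BC∪BC₀ η α
  BC-mono ξ≤η (bc₀ _ eq)       = inj₂ eq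
  BC-mono ξ≤η (bc₊ 1≤ξ eq h) = inj₁ (bc₊ (≤ᵒ-trans 1≤ξ ξ≤η) eq λ n →
    let ζ , ζ<ξ , v = h n in ζ , <-≤ᵒ-trans ζ<ξ ξ≤η , v)

  BC-resp-≈ : ξ ≈ᵒ η → BC P ξ ⊆ BC P η
  BC-resp-≈ ξ≈η (bc₀ ξ≈0 eq)    = bc₀ (≈ᵒ-trans (≈ᵒ-sym ξ≈η) ξ≈0) eq
  BC-resp-≈ ξ≈η (bc₊ 1≤ξ eq h) = bc₊ (≤ᵒ-trans 1≤ξ (proj₁ ξ≈η)) eq λ n →
    let ζ , ζ<ξ , v = h n in ζ , <-≤ᵒ-trans ζ<ξ (proj₁ ξ≈η) , v

  BC₊-≐ : 1ᵒ ≤ᵒ ξ → BC P ξ ≐ (λ α → α 0 ≡ 1) ∩ ⋂ ℕ (ValueIn (BC< ξ))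
  BC₊-≐ {ξ} 1≤ξ = unfold , fold
    where
    unfold : BC P ξ ⊆ (λ α → α 0 ≡ 1) ∩ ⋂ ℕ (ValueIn (BC< ξ))
    unfold (bc₀ ξ≈0 _)   = contradiction (≤ᵒ-trans 1≤ξ (proj₁ ξ≈0)) 1≰0
    unfold (bc₊ _ eq h) = eq , λ n →
      let ζ , ζ<ξ , β , (nβ , _) , b = h n in β , nβ , ζ , ζ<ξ , b

    fold : (λ α → α 0 ≡ 1) ∩ ⋂ ℕ (ValueIn (BC< ξ)) ⊆ BC P ξ
    fold {α} (eq , h) = bc₊ 1≤ξ eq λ n →
      let β , nβ , ζ , ζ<ξ , b = h n in ζ , ζ<ξ , β , Names⇒Value {α} nβ , b

  -- A level below `lsup f` is at most some `f n`, where monotonicity applies; level 0 is itself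
  -- below `lsup f`.
  BC<-≐ : ∀ f → (BC< lsup f) ≐ ⋃ ℕ (λ n → BC∪BC₀ (f n))
  BC<-≐ f = (λ { (ζ , <lsup n ζ≤ , b) → n , BC-mono ζ≤ b })
          , λ { (n , inj₁ b)  → f n , <lsup n ≤ᵒ-refl , b
              ; (n , inj₂ eq) → 0ᵒ , <lsup 0 0≤ , bc₀ (≤ᵒ-refl , ≤ᵒ-refl) eq }

  first≡-locallyConstant : ∀ k → LocallyConstant (λ α → α 0 ≡ k)
  first≡-locallyConstant k α = 1 , λ β αβ →
    trans (sym (αβ 0 ℕₚ.0<1+n)) , trans (αβ 0 ℕₚ.0<1+n)

  BC<-Π⁰ : ∀ f → (∀ n → Π⁰ (sucᵒ (f n)) (BC∪BC₀ (f n))) → Π⁰ (sucᵒ (lsup f)) (BC< lsup f)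
  BC<-Π⁰ f h with em {∃ λ n → ∀ m → f m ≤ᵒ f n}
  -- Successor case: `lsup f` is the successor of `f n`, and the union collapses to its term at `n`.
  ... | yes (n , maximal) = Π⁰-mono (suc-mono-≤ᵒ (<ᵒ⇒≤ᵒ (<lsup n ≤ᵒ-refl))) (Π⁰-resp-≐
    ( (λ b → raise (proj₁ (BC<-≐ f) b))
    , (λ b → proj₂ (BC<-≐ f) (n , b))) (h n))
    where
    raise : ⋃ ℕ (λ m → BC∪BC₀ (f m)) ⊆ BC∪BC₀ (f n)
    raise (m , inj₁ b)  = BC-mono (maximal m) b
    raise (m , inj₂ eq) = inj₂ eq
  -- Limit case: even the successor of each `f n` stays below `lsup f`, so the union is Σ⁰ at
  -- `lsup f`.
  ... | no  none = Σ⁰⇒Π⁰ <ᵒsuc (isUnion (≤-<ᵒ-trans (suc-mono-≤ᵒ 0≤) (suc< 0)) (sucᵒ ∘ f) _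
    (λ n → suc-mono-≤ᵒ 0≤ , suc< n , h n) (BC<-≐ f))
    where
    suc< : ∀ n → sucᵒ (f n) <ᵒ lsup f
    suc< n with em {∃ λ m → f n <ᵒ f m}
    ... | yes (m , fn<fm) = <lsup m (<ᵒ⇒suc≤ᵒ fn<fm)
    ... | no  none′       = contradiction (n , λ m → bounded m (≤ᵒ-or-> (f m) (f n))) none
      where
      bounded : ∀ m → f m ≤ᵒ f n ⊎ f n <ᵒ f m → f m ≤ᵒ f n
      bounded m (inj₁ p) = p
      bounded m (inj₂ p) = contradiction (m , p) none′

  -- The recursion is structural in the denotation. The index `sucᵒ (lsup f)` exceeds 1, as the Π⁰₂
  -- complexity of `Domain` demands.
  BC-Π⁰     : ∀ f → Π⁰ (sucᵒ (lsup f)) (BC P (lsup f))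
  BC∪BC₀-Π⁰ : ∀ ξ → Π⁰ (sucᵒ ξ) (BC∪BC₀ ξ)
  BC-Π⁰ f = Π⁰-resp-≐ (BC₊-≐ 1≤lsup)
    (Π⁰-∩ (clopen⇒Π⁰ (suc-mono-≤ᵒ 0≤) (first≡-locallyConstant 1))
          (Π⁰-⋂ (Π⁰-ValueIn (≤ᵒ⇒<ᵒsuc 1≤lsup) (BC<-Π⁰ f λ n → BC∪BC₀-Π⁰ (f n)))))
  BC∪BC₀-Π⁰ 0ᵒ       = Π⁰-resp-≐
    ( (λ { (inj₁ (bc₀ _ eq)) → eq ; (inj₁ (bc₊ 1≤0 _ _)) → contradiction 1≤0 1≰0 ; (inj₂ eq) → eq })
    , inj₂)
    (clopen⇒Π⁰ ≤ᵒ-refl (first≡-locallyConstant 0))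
  BC∪BC₀-Π⁰ (lsup f) = Π⁰-∪-clopen (first≡-locallyConstant 0) (BC-Π⁰ f)

-- The functions rbc and apb

-- apb exists for every rbc that is a function of ordinals rather than of their denotations.
module Apb (em₁ : ExcludedMiddle (lsuc 0ℓ)) (rbc : ω₁ → ω₁)
           (rbc-resp-≈ : ∀ {ξ η} → 1ᵒ ≤ᵒ ξ → ξ ≈ᵒ η → rbc ξ ≤ᵒ rbc η) where
  open Classical em₁

  _⊔ᵒ_ : ω₁ → ω₁ → ω₁
  ξ ⊔ᵒ η = proj₁ (max ξ η)

  ⊔ᵒ-isMax : ∀ ξ η → IsMax ξ η (ξ ⊔ᵒ η)
  ⊔ᵒ-isMax ξ η = proj₂ (max ξ η)

  ≤⊔ᵒˡ : ∀ ξ η → ξ ≤ᵒ (ξ ⊔ᵒ η)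
  ≤⊔ᵒˡ ξ η = IsMax⇒≥ˡ (⊔ᵒ-isMax ξ η)

  ≤⊔ᵒʳ : ∀ ξ η → η ≤ᵒ (ξ ⊔ᵒ η)
  ≤⊔ᵒʳ ξ η = IsMax⇒≥ʳ (⊔ᵒ-isMax ξ η)

  ⊔ᵒ≤ : ∀ ξ η {τ} → ξ ≤ᵒ τ → η ≤ᵒ τ → (ξ ⊔ᵒ η) ≤ᵒ τ
  ⊔ᵒ≤ ξ η = IsMax⇒≤ (⊔ᵒ-isMax ξ η)

  -- σ stands for the supremum of ApbTerm rbc apb ξ.
  apbAt : ω₁ → ω₁ → ω₁
  apbAt ξ σ with ≤ᵒ-or-> ξ 1ᵒ
  ... | inj₁ _ = 1ᵒ
  ... | inj₂ _ = sucᵒ σ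

  term : ω₁ → ω₁ → ω₁
  term ξ σ = apbAt ξ σ ⊔ᵒ sucᵒ (rbc ξ)

  -- The case split reflects that `ApbTerm` ranges over ordinals from 1 on, so 0 adds no term.
  σ⊔term : ω₁ → ω₁ → ω₁
  σ⊔term ξ σ with em {1ᵒ ≤ᵒ ξ}
  ... | yes _ = σ ⊔ᵒ term ξ σ
  ... | no  _ = σ

  -- Up to ≈ᵒ the ordinals below lsup f are the f n and the ordinals below these, so structural
  -- recursion meets every term.
  termSup : ω₁ → ω₁
  termSup 0ᵒ       = 0ᵒ
  termSup (lsup f) = sup λ n → σ⊔term (f n) (termSup (f n))

  apb : ω₁ → ω₁
  apb ξ = apbAt ξ (termSup ξ)

  apbAt-mono : ∀ {ξ η σ τ} → ξ ≈ᵒ η → σ ≤ᵒ τ → apbAt ξ σ ≤ᵒ apbAt η τ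
  apbAt-mono {ξ} {η} ξ≈η σ≤τ with ≤ᵒ-or-> ξ 1ᵒ | ≤ᵒ-or-> η 1ᵒ
  ... | inj₁ _   | inj₁ _   = ≤ᵒ-refl
  ... | inj₁ _   | inj₂ _   = suc-mono-≤ᵒ 0≤
  ... | inj₂ 1<ξ | inj₁ η≤1 =
    contradiction (<-≤ᵒ-trans 1<ξ (≤ᵒ-trans (proj₁ ξ≈η) η≤1)) 1≮1
  ... | inj₂ _   | inj₂ _   = suc-mono-≤ᵒ σ≤τ

  term-mono : ∀ {ξ η σ τ} → 1ᵒ ≤ᵒ ξ → ξ ≈ᵒ η → σ ≤ᵒ τ → term ξ σ ≤ᵒ term η τ
  term-mono {η = η} {τ = τ} 1≤ξ ξ≈η σ≤τ = ⊔ᵒ≤ _ _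
    (≤ᵒ-trans (apbAt-mono ξ≈η σ≤τ) (≤⊔ᵒˡ (apbAt η τ) _))
    (≤ᵒ-trans (suc-mono-≤ᵒ (rbc-resp-≈ 1≤ξ ξ≈η)) (≤⊔ᵒʳ (apbAt η τ) _))

  σ≤σ⊔term : ∀ ξ {σ} → σ ≤ᵒ σ⊔term ξ σ
  σ≤σ⊔term ξ {σ} with em {1ᵒ ≤ᵒ ξ}
  ... | yes _ = ≤⊔ᵒˡ σ (term ξ σ)
  ... | no  _ = ≤ᵒ-refl

  term≤σ⊔term : 1ᵒ ≤ᵒ ξ → ∀ {σ} → term ξ σ ≤ᵒ σ⊔term ξ σ
  term≤σ⊔term {ξ} 1≤ξ {σ} with em {1ᵒ ≤ᵒ ξ}
  ... | yes _ = ≤⊔ᵒʳ σ (term ξ σ)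
  ... | no  1≰ξ = contradiction 1≤ξ 1≰ξ

  σ⊔term≤ : ∀ {ξ σ τ} → σ ≤ᵒ τ → (1ᵒ ≤ᵒ ξ → term ξ σ ≤ᵒ τ) → σ⊔term ξ σ ≤ᵒ τ
  σ⊔term≤ {ξ} {σ} σ≤τ h with em {1ᵒ ≤ᵒ ξ}
  ... | yes 1≤ξ = ⊔ᵒ≤ σ (term ξ σ) σ≤τ (h 1≤ξ)
  ... | no  _   = σ≤τ

  -- Together these show that `termSup` depends only on the ordinal, although it recurses on a
  -- denotation.
  termSup-mono : ∀ ξ η → ξ ≤ᵒ η → termSup ξ ≤ᵒ termSup η
  termSup-step : ∀ ξ η → ξ <ᵒ η → σ⊔term ξ (termSup ξ) ≤ᵒ termSup η
  termSup-mono 0ᵒ       η _         = 0≤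
  termSup-mono (lsup f) η (lsup≤ h) = sup≤ _ λ n → termSup-step (f n) η (h n)
  termSup-step ξ (lsup f) (<lsup n ξ≤fn) with ≤ᵒ-or-> (f n) ξ
  -- Here `ξ` and `f n` denote the same ordinal, and invariance of `rbc` lets the term at `f n`
  -- bound the one at `ξ`.
  ... | inj₁ fn≤ξ = ≤ᵒ-trans
    (σ⊔term≤ (≤ᵒ-trans (termSup-mono ξ (f n) ξ≤fn) (σ≤σ⊔term (f n))) λ 1≤ξ →
      ≤ᵒ-trans (term-mono 1≤ξ (ξ≤fn , fn≤ξ) (termSup-mono ξ (f n) ξ≤fn))
               (term≤σ⊔term (≤ᵒ-trans 1≤ξ ξ≤fn)))
    (≤sup _ n)
  ... | inj₂ ξ<fn = ≤ᵒ-trans (termSup-step ξ (f n) ξ<fn) (≤ᵒ-trans (σ≤σ⊔term (f n)) (≤sup _ n))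

  termSup-upper : ∀ ξ ζ → ApbTerm rbc apb ξ ζ → ζ ≤ᵒ termSup ξ
  termSup-upper ξ ζ (η , 1≤η , η<ξ , ζ-max) = ≤ᵒ-trans
    (≤ᵒ-trans (IsMax⇒≤ ζ-max (≤⊔ᵒˡ (apb η) _) (≤⊔ᵒʳ (apb η) _)) (term≤σ⊔term 1≤η))
    (termSup-step η ξ η<ξ)

  termSup-least : ∀ ξ τ → (∀ ζ → ApbTerm rbc apb ξ ζ → ζ ≤ᵒ τ) → termSup ξ ≤ᵒ τ
  termSup-least 0ᵒ       τ h = 0≤
  termSup-least (lsup f) τ h = sup≤ _ λ n → σ⊔term≤
    (termSup-least (f n) τ λ ζ (η , 1≤η , η<fn , ζ-max) →
      h ζ (η , 1≤η , <lsup n (<ᵒ⇒≤ᵒ η<fn) , ζ-max))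
    (λ 1≤fn → h _ (f n , 1≤fn , <lsup n ≤ᵒ-refl , ⊔ᵒ-isMax _ _))

  apb-isApb : IsApb rbc apb
  apb-isApb = record { apb-1 = at-1 ; apb->1 = above-1 }
    where
    at-1 : ∀ ξ → ξ ≈ᵒ 1ᵒ → apb ξ ≈ᵒ 1ᵒ
    at-1 ξ ξ≈1 with ≤ᵒ-or-> ξ 1ᵒ
    ... | inj₁ _   = ≤ᵒ-refl , ≤ᵒ-refl
    ... | inj₂ 1<ξ = contradiction (<-≤ᵒ-trans 1<ξ (proj₁ ξ≈1)) 1≮1

    above-1 : ∀ ξ → 1ᵒ <ᵒ ξ → ∃ λ σ → IsSup (ApbTerm rbc apb ξ) σ × apb ξ ≈ᵒ sucᵒ σ
    above-1 ξ 1<ξ with ≤ᵒ-or-> ξ 1ᵒ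
    ... | inj₁ ξ≤1 = contradiction (<-≤ᵒ-trans 1<ξ ξ≤1) 1≮1
    ... | inj₂ _   = termSup ξ , (termSup-upper ξ , termSup-least ξ) , ≤ᵒ-refl , ≤ᵒ-refl

-- Existence of rbc and the two bounds

module _ (em₁ : ExcludedMiddle (lsuc 0ℓ)) (P : RecursivePresentation-ω×ω) where
  open Classical em₁
  open Codes em₁ P

  BC-Π⁰-suc : ∀ ξ → 1ᵒ ≤ᵒ ξ → Π⁰ (sucᵒ ξ) (BC P ξ)
  BC-Π⁰-suc 0ᵒ       1≤0 = contradiction 1≤0 1≰0
  BC-Π⁰-suc (lsup f) _   = BC-Π⁰ f

  rbc-exists : ∃ (IsRbc P)
  rbc-exists = (λ ξ → proj₁ (leastIndex ξ)) , λ ξ 1≤ξ →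
    let Π , minimal = proj₂ (leastIndex ξ) in Π 1≤ξ , λ ζ p → minimal ζ λ _ → p
    where
    -- With the premise inside the predicate, a least index exists for 0 as well, which makes the
    -- function total.
    leastIndex : ∀ ξ → ∃ (IsLeast λ η → 1ᵒ ≤ᵒ ξ → 1ᵒ ≤ᵒ η × Π⁰ η (BC P ξ))
    leastIndex ξ = least em₁ _ (sucᵒ ξ , λ 1≤ξ → suc-mono-≤ᵒ 0≤ , BC-Π⁰-suc ξ 1≤ξ)

  rbc≤suc : ∀ {rbc} → IsRbc P rbc → ∀ ξ → 1ᵒ ≤ᵒ ξ → rbc ξ ≤ᵒ sucᵒ ξ
  rbc≤suc isRbc ξ 1≤ξ = proj₂ (isRbc ξ 1≤ξ) (sucᵒ ξ) (suc-mono-≤ᵒ 0≤ , BC-Π⁰-suc ξ 1≤ξ)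

  rbc-resp-≈ : ∀ {rbc} → IsRbc P rbc → 1ᵒ ≤ᵒ ξ → ξ ≈ᵒ η → rbc ξ ≤ᵒ rbc η
  rbc-resp-≈ {ξ} {η} isRbc 1≤ξ ξ≈η =
    let 1≤rbc , Π = proj₁ (isRbc η (≤ᵒ-trans 1≤ξ (proj₁ ξ≈η))) in
    proj₂ (isRbc ξ 1≤ξ) _ (1≤rbc , Π⁰-resp-≐ (BC-resp-≈ ξ≈η , BC-resp-≈ (≈ᵒ-sym ξ≈η)) Π)

  -- For η < ξ both apb(η) and rbc(η)+1 are at most η+2, hence at most ξ+1; so is their supremum,
  -- and apb(ξ) is its successor.
  apb≤suc-suc : ∀ {rbc apb} → IsRbc P rbc → IsApb rbc apb →
                ∀ ξ → 1ᵒ ≤ᵒ ξ → apb ξ ≤ᵒ sucᵒ (sucᵒ ξ)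
  apb≤suc-suc {rbc} {apb} isRbc isApb ξ = go ξ (<ᵒ-wellFounded ξ)
    where
    go : ∀ ξ → Acc _<ᵒ_ ξ → 1ᵒ ≤ᵒ ξ → apb ξ ≤ᵒ sucᵒ (sucᵒ ξ)
    go ξ (acc rs) 1≤ξ with ≤ᵒ-or-> ξ 1ᵒ
    ... | inj₁ ξ≤1 = ≤ᵒ-trans (proj₁ (IsApb.apb-1 isApb ξ (ξ≤1 , 1≤ξ))) (suc-mono-≤ᵒ 0≤)
    ... | inj₂ 1<ξ with IsApb.apb->1 isApb ξ 1<ξ
    ... | σ , (_ , σ-least) , apb≈ = ≤ᵒ-trans (proj₁ apb≈) (suc-mono-≤ᵒ (σ-least (sucᵒ ξ)
      λ ζ (η , 1≤η , η<ξ , ζ-max) → let suc-η≤ξ = <ᵒ⇒suc≤ᵒ η<ξ in IsMax⇒≤ ζ-max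
        (≤ᵒ-trans (go η (rs η<ξ) 1≤η) (suc-mono-≤ᵒ suc-η≤ξ))
        (suc-mono-≤ᵒ (≤ᵒ-trans (rbc≤suc isRbc η 1≤η) suc-η≤ξ))))

proposition6 : ExcludedMiddle (lsuc 0ℓ) →
    (P : RecursivePresentation-ω×ω) →
    (∃₂ λ rbc apb → IsRbc P rbc × IsApb rbc apb) ×
    (∀ rbc apb → IsRbc P rbc → IsApb rbc apb →
    ∀ ξ → 1ᵒ ≤ᵒ ξ → rbc ξ ≤ᵒ sucᵒ ξ × apb ξ ≤ᵒ sucᵒ (sucᵒ ξ))
proposition6 em₁ P =
  (let rbc , isRbc = rbc-exists em₁ P
       open Apb em₁ rbc (rbc-resp-≈ em₁ P isRbc)
   in rbc , apb , isRbc , apb-isApb) ,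
  λ rbc apb isRbc isApb ξ 1≤ξ →
    rbc≤suc em₁ P isRbc ξ 1≤ξ , apb≤suc-suc em₁ P isRbc isApb ξ 1≤ξ
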